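{- There are absolute constants $c>0$ and $c'>0$ such that for every $N \in \mathbb{N}$ there are a set $A \subset \mathbb{F}_2^\infty$ of size $|A|=N$ and a $k \in \mathbb{N}$ with $k \geq c' N^{\frac{1}{2}+c}$ such that $A$ is not $k$-stable (in $\mathbb{F}_2^\infty$). (That is, there is a set $A$ of size $N$ that is not $\Omega(N^{\frac{1}{2}+c})$-stable.)
   Context: $\mathbb{N}=\{1,2,3,\dots\}$. $\mathbb{F}_2^\infty$ denotes the direct sum of countably many copies of $\mathbb{F}_2$, regarded as an additive Abelian group. Let $G$ be an Abelian group, $A \subset G$ and $k \in \mathbb{N}$. The set $A$ has the $k$-order property (in $G$) if there are vectors $s=(s_1,\dots,s_k)$ and $t=(t_1,\dots,t_k)$ in $G^k$ such that for all $1 \leq i,j \leq k$ one has $s_i+t_j \in A$ if and only if $i \leq j$. The set $A$ is $k$-stable (in $G$) if it does not have the $k$-order property. -}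

module Defs where

open import Algebra.Bundles using (AbelianGroup)
import Algebra.Construct.Pointwise as Pointwise
import Algebra.Properties.Group as GroupProperties
open import Data.Fin.Base as Fin using (Fin)
open import Data.Integer.Base using (+_; ∣_∣)
open import Data.Nat.Base as ℕ using (ℕ; _⊔_)
import Data.Nat.Properties as ℕ
open import Data.Parity.Properties using (+-0-abelianGroup)
open import Data.Product.Base using (Σ; Σ-syntax; ∃-syntax; _,_; proj₁)
open import Data.Rational.Base as ℚ using (ℚ; ↥_; ↧ₙ_; +-*-rawSemiring)
open import Data.Vec.Functional using (Vector)
open import Algebra.Definitions.RawSemiring +-*-rawSemiring using (_^_)
open import Function.Bundles using (_⇔_; Bijection)
open import Level using (Level; 0ℓ; suc) renaming (_⊔_ to _⊔ˡ_)
open import Relation.Binary.Bundles using (Setoid)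
open import Relation.Binary.Definitions using (_Respects_)
import Relation.Binary.Construct.On as On
import Relation.Binary.PropositionalEquality.Properties as ≡
open import Relation.Nullary.Negation.Core using (¬_)
open import Relation.Unary using (Pred)

private
  variable
    a ℓ : Level

module _ (G : AbelianGroup a ℓ) where
  open AbelianGroup G

  record Subset (p : Level) : Set (a ⊔ˡ ℓ ⊔ˡ suc p) where
    field
      member   : Pred Carrier p
      respects : member Respects _≈_

  infix 4 _∈_
  _∈_ : ∀ {p} → Carrier → Subset p → Set p
  x ∈ A = Subset.member A x

  -- Elements of A are counted up to the equality of G, so membership proofs
  -- do not contribute to the size.
  HasSize : ∀ {p} → Subset p → ℕ → Set (a ⊔ˡ ℓ ⊔ˡ p)
  HasSize A n =
    Bijection (≡.setoid (Fin n)) (On.setoid setoid (proj₁ {B = λ x → x ∈ A}))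

  OrderProperty : ∀ {p} → ℕ → Subset p → Set (a ⊔ˡ p)
  OrderProperty k A =
    Σ[ s ∈ Vector Carrier k ] Σ[ t ∈ Vector Carrier k ]
      (∀ i j → (s i ∙ t j ∈ A) ⇔ (i Fin.≤ j))

  Stable : ∀ {p} → ℕ → Subset p → Set (a ⊔ˡ p)
  Stable k A = ¬ OrderProperty k A

-- The direct sum of countably many copies of G: sequences that vanish from
-- some index on, compared pointwise (the bound is not part of the element).
module _ (G : AbelianGroup a ℓ) where
  private
    module G = AbelianGroup G
    module GP = GroupProperties G.group
    module Seq = AbelianGroup (Pointwise.abelianGroup ℕ G)

  FinitelySupported : Pred (ℕ → G.Carrier) ℓ
  FinitelySupported f = ∃[ b ] (∀ i → b ℕ.≤ i → f i G.≈ G.ε)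

  directSum : AbelianGroup (a ⊔ˡ ℓ) ℓ
  directSum = record
    { Carrier = Σ (ℕ → G.Carrier) FinitelySupported
    ; _≈_ = λ (f , _) (g , _) → f Seq.≈ g
    ; _∙_ = λ (f , b , p) (g , c , q) →
        f Seq.∙ g , b ⊔ c , λ i b⊔c≤i →
          G.trans (G.∙-cong (p i (ℕ.m⊔n≤o⇒m≤o b c b⊔c≤i))
                            (q i (ℕ.m⊔n≤o⇒n≤o b c b⊔c≤i)))
                  (G.identityˡ G.ε)
    ; ε = Seq.ε , 0 , λ _ _ → G.refl
    ; _⁻¹ = λ (f , b , p) →
        f Seq.⁻¹ , b , λ i b≤i → G.trans (G.⁻¹-cong (p i b≤i)) GP.ε⁻¹≈ε
    ; isAbelianGroup = record
      { isGroup = record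
        { isMonoid = record
          { isSemigroup = record
            { isMagma = record
              { isEquivalence = On.isEquivalence proj₁ Seq.isEquivalence
              ; ∙-cong = Seq.∙-cong
              }
            ; assoc = λ (f , _) (g , _) (h , _) → Seq.assoc f g h
            }
          ; identity = (λ (f , _) → Seq.identityˡ f) , (λ (f , _) → Seq.identityʳ f)
          }
        ; inverse = (λ (f , _) → Seq.inverseˡ f) , (λ (f , _) → Seq.inverseʳ f)
        ; ⁻¹-cong = Seq.⁻¹-cong
        }
      ; comm = λ (f , _) (g , _) → Seq.comm f g
      }
    }

-- 𝔽₂ as an additive group is Parity with parity addition.
𝔽₂^∞ : AbelianGroup 0ℓ 0ℓ
𝔽₂^∞ = directSum +-0-abelianGroup

fromℕ : ℕ → ℚ
fromℕ n = + n ℚ./ 1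

-- k ≥ C · N^r, meaningful only for rational C, r ≥ 0.  With r = m / d in lowest
-- terms, N^r is the nonnegative real whose d-th power is N^m, so raising both
-- (nonnegative) sides to the d-th power turns the inequality into
-- k^d ≥ C^d · N^m.
infix 4 _≥_·_^ʳ_
_≥_·_^ʳ_ : ℕ → ℚ → ℕ → ℚ → Set
k ≥ C · N ^ʳ r = fromℕ k ^ ↧ₙ r ℚ.≥ (C ^ ↧ₙ r) ℚ.* (fromℕ N ^ ∣ ↥ r ∣)

{-# OPTIONS --safe #-}

-- In 𝔽₂⁴ there are s₁,…,s₄ and t₁,…,t₄ whose sixteen sums sᵢ + tⱼ take only
-- twelve values, each of which determines whether i < j, i = j or i > j.  In the
-- n-th power, with indices compared lexicographically, there are 4ⁿ rows and
-- columns and at most 12ⁿ sums, each still determining the comparison.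
-- Collecting the sums with i ≤ j, and padding with unit vectors from fresh
-- coordinates, gives a set of any prescribed size N ≥ 12ⁿ with the 4ⁿ-order
-- property.  Taking n with 12ⁿ ≤ N < 12ⁿ⁺¹ yields the exponent 5/9 because
-- 12⁵ ≤ 4⁹.

module Submission where

open import Defs
open import Level using (0ℓ)
open import Data.Nat.Base using (ℕ; NonZero)
open import Data.Product.Base using (Σ-syntax; _×_)
open import Data.Rational.Base using (ℚ; 0ℚ; ½; _+_; _>_)
open import Relation.Nullary.Negation.Core using (¬_)

open import Algebra.Bundles using (AbelianGroup; CommutativeRing)
import Algebra.Properties.CommutativeSemiring.Exp as Exp
open import Data.Empty using (⊥-elim)
open import Data.Fin.Base as Fin using (Fin; combine; quotient; remainder; remQuot; toℕ; inject≤)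
import Data.Fin.Properties as Fin
open import Data.Integer.Base as ℤ using (+_)
import Data.Integer.Properties as ℤ
open import Data.Nat.Base as ℕ using (zero; suc; z≤n; s≤s)
import Data.Nat.Properties as ℕ
open import Data.Parity.Base as Parity using (Parity) renaming (0ℙ to O; 1ℙ to I)
import Data.Parity.Properties as Parity
open import Data.Product.Base using (_,_; uncurry)
open import Data.Rational.Base as ℚ using (_/_; toℚᵘ)
import Data.Rational.Properties as ℚ
open import Data.Rational.Unnormalised.Base as ℚᵘ using (mkℚᵘ; *≡*; *≤*)
import Data.Rational.Unnormalised.Properties as ℚᵘ
open import Data.Vec.Base as Vec using (Vec; []; _∷_; _++_; zipWith; lookup)
import Data.Vec.Properties as Vec
open import Function.Base using (_∘_; case_of_)
open import Function.Bundles using (_⇔_; mk⇔; module Equivalence)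
open import Relation.Binary.PropositionalEquality
  using (_≡_; _≢_; refl; sym; trans; cong; cong₂; subst; subst₂; _≗_)
open import Relation.Nullary.Decidable using (Dec; yes; no; from-yes; _×-dec_; _→-dec_; ¬?)

open Exp (CommutativeRing.commutativeSemiring ℚ.+-*-commutativeRing) using (_^_; ^-distrib-*)

-- Lexicographic comparison of indices

data Side : Set where
  below diagonal above : Side

_≟ˢ_ : (x y : Side) → Dec (x ≡ y)
below    ≟ˢ below    = yes refl
below    ≟ˢ diagonal = no λ ()
below    ≟ˢ above    = no λ ()
diagonal ≟ˢ below    = no λ ()
diagonal ≟ˢ diagonal = yes refl
diagonal ≟ˢ above    = no λ ()
above    ≟ˢ below    = no λ ()
above    ≟ˢ diagonal = no λ ()
above    ≟ˢ above    = yes refl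

-- The lexicographic rule: the second comparison counts only on a tie in the first. This is why
-- `diagonal` is kept apart from `above`, although the order property merges them.
_then_ : Side → Side → Side
below    then y = below
diagonal then y = y
above    then y = above

Compares : ∀ {k} → Side → Fin k → Fin k → Set
Compares below    i j = j Fin.< i
Compares diagonal i j = i ≡ j
Compares above    i j = i Fin.< j

compares? : ∀ {k} x (i j : Fin k) → Dec (Compares x i j)
compares? below    i j = j Fin.<? i
compares? diagonal i j = i Fin.≟ j
compares? above    i j = i Fin.<? j

≢below⇔≤ : ∀ {k} x {i j : Fin k} → Compares x i j → x ≢ below ⇔ i Fin.≤ j
≢below⇔≤ below    j<i  = mk⇔ (λ x≢x → ⊥-elim (x≢x refl)) (λ i≤j → ⊥-elim (ℕ.<⇒≱ j<i i≤j))
≢below⇔≤ diagonal refl = mk⇔ (λ _ → ℕ.≤-refl) (λ _ ())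
≢below⇔≤ above    i<j  = mk⇔ (λ _ → ℕ.<⇒≤ i<j) (λ _ ())

combine-monoʳ-< : ∀ {k l} (i : Fin k) {i′ j′ : Fin l} → i′ Fin.< j′ → combine i i′ Fin.< combine i j′
combine-monoʳ-< {l = l} i {i′} {j′} i′<j′ =
  subst₂ ℕ._<_ (sym (Fin.toℕ-combine i i′)) (sym (Fin.toℕ-combine i j′))
    (ℕ.+-monoʳ-< (l ℕ.* toℕ i) i′<j′)

-- Numerically `combine i i′` is `l * i + i′` with `i′ < l`, so the order on `Fin (k * l)` is the
-- lexicographic order on pairs.
combine-compares : ∀ {k l} x y {i j : Fin k} {i′ j′ : Fin l} →
  Compares x i j → Compares y i′ j′ → Compares (x then y) (combine i i′) (combine j j′)
combine-compares below    _        {i′ = i′} {j′} p _ = Fin.combine-monoˡ-< j′ i′ p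
combine-compares above    _        {i′ = i′} {j′} p _ = Fin.combine-monoˡ-< i′ j′ p
combine-compares diagonal below    {i} refl q = combine-monoʳ-< i q
combine-compares diagonal diagonal refl refl = refl
combine-compares diagonal above    {i} refl q = combine-monoʳ-< i q

-- Addition tables and their products

infixl 6 _⊕_
_⊕_ : ∀ {m} → Vec Parity m → Vec Parity m → Vec Parity m
_⊕_ = zipWith Parity._+_

-- A `k` by `k` addition table whose sums lie among `l` distinct vectors. Since `side` is attached
-- to the vector and not to the position, equal sums at different positions must compare alike.
record ComparisonTable (k l m : ℕ) : Set where
  field
    row col         : Fin k → Vec Parity m
    value           : Fin l → Vec Parity m
    side            : Fin l → Side
    entry           : Fin k → Fin k → Fin l
    value-injective : ∀ x y → value x ≡ value y → x ≡ y
    value-entry     : ∀ i j → value (entry i j) ≡ row i ⊕ col j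
    side-entry      : ∀ i j → Compares (side (entry i j)) i j

unitTable : ComparisonTable 1 1 0
unitTable = record
  { row             = λ _ → []
  ; col             = λ _ → []
  ; value           = λ _ → []
  ; side            = λ _ → diagonal
  ; entry           = λ _ _ → Fin.zero
  ; value-injective = λ { Fin.zero Fin.zero _ → refl }
  ; value-entry     = λ _ _ → refl
  ; side-entry      = λ { Fin.zero Fin.zero → refl }
  }

-- A concatenated sum reveals both of its halves, hence the sides of both, and these determine the
-- lexicographic comparison.
_⊗_ : ∀ {k l m k′ l′ m′} → ComparisonTable k l m → ComparisonTable k′ l′ m′ →
      ComparisonTable (k ℕ.* k′) (l ℕ.* l′) (m ℕ.+ m′)
_⊗_ {k} {l} {m} {k′} {l′} {m′} S T = record
  { row   = λ i → S.row (quotient k′ i) ++ T.row (remainder {k} k′ i)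
  ; col   = λ j → S.col (quotient k′ j) ++ T.col (remainder {k} k′ j)
  ; value = uncurry value ∘ remQuot l′
  ; side  = uncurry side ∘ remQuot l′
  ; entry = λ i j → combine (S.entry (quotient k′ i) (quotient k′ j))
                            (T.entry (remainder {k} k′ i) (remainder {k} k′ j))
  ; value-injective = λ x y eq →
      let eqˡ , eqʳ = Vec.++-injective (S.value (quotient l′ x)) (S.value (quotient l′ y)) eq in
      trans (sym (Fin.combine-remQuot {l} l′ x))
        (trans (cong₂ combine (S.value-injective _ _ eqˡ) (T.value-injective _ _ eqʳ))
          (Fin.combine-remQuot {l} l′ y))
  ; value-entry = λ i j →
      trans (cong (uncurry value) (Fin.remQuot-combine {l} {l′} _ _))
        (trans (cong₂ _++_ (S.value-entry _ _) (T.value-entry _ _))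
          (sym (Vec.zipWith-++ Parity._+_ (S.row (quotient k′ i)) _ (S.col (quotient k′ j)) _)))
  ; side-entry = λ i j →
      subst (λ x → Compares x i j) (cong (uncurry side) (sym (Fin.remQuot-combine {l} {l′} _ _)))
        (subst₂ (Compares _) (Fin.combine-remQuot {k} k′ i) (Fin.combine-remQuot {k} k′ j)
          (combine-compares (S.side _) (T.side _) (S.side-entry _ _) (T.side-entry _ _)))
  }
  where
  module S = ComparisonTable S
  module T = ComparisonTable T

  value : Fin l → Fin l′ → Vec Parity (m ℕ.+ m′)
  value x y = S.value x ++ T.value y

  side : Fin l → Fin l′ → Side
  side x y = S.side x then T.side y

power : ∀ {k l m} → ComparisonTable k l m → ∀ n → ComparisonTable (k ℕ.^ n) (l ℕ.^ n) (n ℕ.* m)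
power T zero    = unitTable
power T (suc n) = T ⊗ power T n

-- Found by computer search.  The coincidences are s₁ + t₃ = s₂ + t₄,
-- s₁ + t₄ = s₂ + t₃, s₃ + t₁ = s₄ + t₂ and s₃ + t₂ = s₄ + t₁.
baseTable : ComparisonTable 4 12 4
baseTable = record
  { row             = lookup rows
  ; col             = lookup cols
  ; value           = lookup values
  ; side            = lookup sides
  ; entry           = λ i → lookup (lookup entries i)
  ; value-injective = from-yes (Fin.all? λ x → Fin.all? λ y →
      (lookup values x ≟ lookup values y) →-dec (x Fin.≟ y))
  ; value-entry     = from-yes (Fin.all? λ i → Fin.all? λ j →
      lookup values (lookup (lookup entries i) j) ≟ lookup rows i ⊕ lookup cols j)
  ; side-entry      = from-yes (Fin.all? λ i → Fin.all? λ j →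
      compares? (lookup sides (lookup (lookup entries i) j)) i j)
  }
  where
  open import Data.Fin.Patterns

  pattern 10F = Fin.suc 9F
  pattern 11F = Fin.suc 10F

  infix 4 _≟_
  _≟_ : (u v : Vec Parity 4) → Dec (u ≡ v)
  _≟_ = Vec.≡-dec Parity._≟_

  rows cols : Vec (Vec Parity 4) 4
  rows = (O ∷ O ∷ O ∷ O ∷ []) ∷ (O ∷ O ∷ O ∷ I ∷ []) ∷ (O ∷ I ∷ O ∷ O ∷ []) ∷ (O ∷ I ∷ I ∷ O ∷ []) ∷ []
  cols = (O ∷ O ∷ O ∷ O ∷ []) ∷ (O ∷ O ∷ I ∷ O ∷ []) ∷ (I ∷ O ∷ O ∷ O ∷ []) ∷ (I ∷ O ∷ O ∷ I ∷ []) ∷ []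

  values : Vec (Vec Parity 4) 12
  values =
    (O ∷ O ∷ O ∷ O ∷ []) ∷ (O ∷ O ∷ I ∷ I ∷ []) ∷ (I ∷ I ∷ O ∷ O ∷ []) ∷ (I ∷ I ∷ I ∷ I ∷ []) ∷
    (O ∷ O ∷ I ∷ O ∷ []) ∷ (I ∷ O ∷ O ∷ O ∷ []) ∷ (I ∷ O ∷ O ∷ I ∷ []) ∷ (I ∷ I ∷ O ∷ I ∷ []) ∷
    (O ∷ O ∷ O ∷ I ∷ []) ∷ (O ∷ I ∷ O ∷ O ∷ []) ∷ (O ∷ I ∷ I ∷ O ∷ []) ∷ (I ∷ I ∷ I ∷ O ∷ []) ∷ []

  sides : Vec Side 12
  sides = Vec.replicate 4 diagonal ++ Vec.replicate 4 above ++ Vec.replicate 4 below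

  entries : Vec (Vec (Fin 12) 4) 4
  entries =
    (0F  ∷ 4F  ∷ 5F  ∷ 6F ∷ []) ∷
    (8F  ∷ 1F  ∷ 6F  ∷ 5F ∷ []) ∷
    (9F  ∷ 10F ∷ 2F  ∷ 7F ∷ []) ∷
    (10F ∷ 9F  ∷ 11F ∷ 3F ∷ []) ∷ []

-- Finite vectors inside the direct sum

module 𝔽 = AbelianGroup 𝔽₂^∞

pad : ∀ {m} → Vec Parity m → ℕ → Parity
pad []       _       = O
pad (x ∷ xs) zero    = x
pad (x ∷ xs) (suc a) = pad xs a

pad-support : ∀ {m} (u : Vec Parity m) a → m ℕ.≤ a → pad u a ≡ O
pad-support []       _       _         = refl
pad-support (_ ∷ xs) (suc a) (s≤s m≤a) = pad-support xs a m≤a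

pad-⊕ : ∀ {m} (u v : Vec Parity m) → pad (u ⊕ v) ≗ λ a → pad u a Parity.+ pad v a
pad-⊕ []       []       _       = refl
pad-⊕ (_ ∷ _)  (_ ∷ _)  zero    = refl
pad-⊕ (_ ∷ xs) (_ ∷ ys) (suc a) = pad-⊕ xs ys a

pad-injective : ∀ {m} (u v : Vec Parity m) → pad u ≗ pad v → u ≡ v
pad-injective []       []       _  = refl
pad-injective (_ ∷ xs) (_ ∷ ys) eq = cong₂ _∷_ (eq 0) (pad-injective xs ys (eq ∘ suc))

unit : ℕ → ℕ → Parity
unit zero    zero    = I
unit zero    (suc _) = O
unit (suc _) zero    = O
unit (suc b) (suc a) = unit b a

unit-diagonal : ∀ b → unit b b ≡ I
unit-diagonal zero    = refl
unit-diagonal (suc b) = unit-diagonal b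

unit-support : ∀ b a → b ℕ.< a → unit b a ≡ O
unit-support zero    (suc _) _         = refl
unit-support (suc b) (suc a) (s≤s b<a) = unit-support b a b<a

unit-injective : ∀ a b → unit a ≗ unit b → a ≡ b
unit-injective zero    zero    _  = refl
unit-injective zero    (suc _) eq = case eq 0 of λ ()
unit-injective (suc _) zero    eq = case eq 0 of λ ()
unit-injective (suc a) (suc b) eq = cong suc (unit-injective a b (eq ∘ suc))

-- At coordinate `b` the padded vector is already zero, while the unit vector is `I`.
pad≉unit : ∀ {m} (u : Vec Parity m) {b} → m ℕ.≤ b → ¬ pad u ≗ unit b
pad≉unit u {b} m≤b eq =
  case trans (sym (pad-support u b m≤b)) (trans (eq b) (unit-diagonal b)) of λ ()

padᶠ : ∀ {m} → Vec Parity m → 𝔽.Carrier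
padᶠ {m} u = pad u , m , pad-support u

unitᶠ : ℕ → 𝔽.Carrier
unitᶠ b = unit b , suc b , unit-support b

-- Sets of prescribed size with the order property

image : ∀ {N} → (Fin N → 𝔽.Carrier) → Subset 𝔽₂^∞ 0ℓ
image f = record
  { member   = λ x → Σ[ z ∈ Fin _ ] f z 𝔽.≈ x
  ; respects = λ {x} {y} x≈y (z , fz≈x) → z , 𝔽.trans {f z} {x} {y} fz≈x x≈y
  }

image-size : ∀ {N} (f : Fin N → 𝔽.Carrier) → (∀ y z → f y 𝔽.≈ f z → y ≡ z) → HasSize 𝔽₂^∞ (image f) N
image-size f f-injective = record
  { to        = λ z → f z , z , λ _ → refl
  ; cong      = λ { refl _ → refl }
  ; bijective = (λ {y} {z} → f-injective y z) , λ (_ , z , fz≈x) → z , λ { refl → fz≈x }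
  }

module _ {k l m N} (T : ComparisonTable k l m) (l≤N : l ℕ.≤ N) where
  open ComparisonTable T

  private
    Kept : Fin N → Set
    Kept z = Σ[ x ∈ Fin l ] toℕ x ≡ toℕ z × side x ≢ below

    kept? : ∀ z → Dec (Kept z)
    kept? z = Fin.any? λ x → (toℕ x ℕ.≟ toℕ z) ×-dec ¬? (side x ≟ˢ below)

    -- Indices of `below` values and indices from `l` on both receive unit vectors, at coordinates
    -- `m + z` outside the table. The decision is an argument so that the lemmas can split on it.
    element : (z : Fin N) → Dec (Kept z) → 𝔽.Carrier
    element z (yes (x , _)) = padᶠ (value x)
    element z (no _)        = unitᶠ (m ℕ.+ toℕ z)

    element-injective : ∀ y z p q → element y p 𝔽.≈ element z q → y ≡ z
    element-injective y z (yes (x , x≡y , _)) (yes (x′ , x′≡z , _)) eq = Fin.toℕ-injective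
      (trans (sym x≡y) (trans (cong toℕ (value-injective x x′ (pad-injective _ _ eq))) x′≡z))
    element-injective y z (yes (x , _)) (no _) eq = ⊥-elim (pad≉unit (value x) (ℕ.m≤m+n m _) eq)
    element-injective y z (no _) (yes (x , _)) eq =
      ⊥-elim (pad≉unit (value x) (ℕ.m≤m+n m _) (sym ∘ eq))
    element-injective y z (no _) (no _) eq =
      Fin.toℕ-injective (ℕ.+-cancelˡ-≡ m _ _ (unit-injective _ _ eq))

    element-kept : ∀ z q x → toℕ x ≡ toℕ z → side x ≢ below → element z q 𝔽.≈ padᶠ (value x)
    element-kept z (yes (y , y≡z , _)) x x≡z _ a =
      -- The decision carries its own witness `y`, which has the same number as `z` and therefore
      -- equals `x`.
      cong (λ w → pad (value w) a) (Fin.toℕ-injective (trans y≡z (sym x≡z)))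
    element-kept z (no ¬kept) x x≡z x≢below = ⊥-elim (¬kept (x , x≡z , x≢below))

    -- A unit vector is never a padded value, and equal padded values have the same index, hence the
    -- same side. Thus no `below` sum enters the set by coincidence.
    element-pad : ∀ z q x → element z q 𝔽.≈ padᶠ (value x) → side x ≢ below
    element-pad z (yes (y , _ , y≢below)) x eq =
      subst (λ w → side w ≢ below) (value-injective y x (pad-injective _ _ eq)) y≢below
    element-pad z (no _) x eq = ⊥-elim (pad≉unit (value x) (ℕ.m≤m+n m _) (sym ∘ eq))

    sum≈entry : ∀ i j → padᶠ (row i) 𝔽.∙ padᶠ (col j) 𝔽.≈ padᶠ (value (entry i j))
    sum≈entry i j a = sym (trans (cong (λ u → pad u a) (value-entry i j)) (pad-⊕ (row i) (col j) a))

  enumeration : Fin N → 𝔽.Carrier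
  enumeration z = element z (kept? z)

  enumeration-injective : ∀ y z → enumeration y 𝔽.≈ enumeration z → y ≡ z
  enumeration-injective y z = element-injective y z (kept? y) (kept? z)

  -- Each sum is the value of its table entry, and a value belongs to the image exactly when its
  -- side is not `below`.
  image-orderProperty : OrderProperty 𝔽₂^∞ k (image enumeration)
  image-orderProperty = padᶠ ∘ row , padᶠ ∘ col , λ i j →
    let x = entry i j
        open Equivalence (≢below⇔≤ (side x) (side-entry i j))
        z = inject≤ x l≤N
    in mk⇔
      (λ (z , eq) → to (element-pad z (kept? z) x (λ a → trans (eq a) (sum≈entry i j a))))
      (λ i≤j → z , λ a → trans
        (element-kept z (kept? z) x (sym (Fin.toℕ-inject≤ x l≤N)) (from i≤j) a)
        (sym (sum≈entry i j a)))

-- Choice of the power and growth of the order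

power-bracket : ∀ b → 1 ℕ.< b → ∀ N → .{{NonZero N}} → Σ[ n ∈ ℕ ] b ℕ.^ n ℕ.≤ N × N ℕ.< b ℕ.^ suc n
power-bracket b 1<b 1 = 0 , ℕ.≤-refl , subst (1 ℕ.<_) (sym (ℕ.*-identityʳ b)) 1<b
power-bracket b 1<b (suc N@(suc _)) with power-bracket b 1<b N
... | n , bⁿ≤N , N<bⁿ⁺¹ with suc N ℕ.<? b ℕ.^ suc n
...   | yes 1+N<bⁿ⁺¹ = n , ℕ.m≤n⇒m≤1+n bⁿ≤N , 1+N<bⁿ⁺¹
-- The exponent moves up here; the old strict bound on `N`, read as `suc N ≤ b ^ suc n`, gives the
-- new upper bound.
...   | no  1+N≮bⁿ⁺¹ = suc n , ℕ.≮⇒≥ 1+N≮bⁿ⁺¹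
                     , ℕ.≤-<-trans N<bⁿ⁺¹ (ℕ.^-monoʳ-< b 1<b (ℕ.n<1+n (suc n)))

-- `fromℕ` normalises its fraction, which blocks computation on a variable; in the unnormalised
-- rationals the denominator is visibly 1.
toℚᵘ-fromℕ : ∀ n → toℚᵘ (fromℕ n) ℚᵘ.≃ mkℚᵘ (+ n) 0
toℚᵘ-fromℕ n = ℚ.toℚᵘ-fromℚᵘ (mkℚᵘ (+ n) 0)

fromℕ-* : ∀ a b → fromℕ (a ℕ.* b) ≡ fromℕ a ℚ.* fromℕ b
fromℕ-* a b = ℚ.toℚᵘ-injective (begin
  toℚᵘ (fromℕ (a ℕ.* b))             ≈⟨ toℚᵘ-fromℕ (a ℕ.* b) ⟩
  mkℚᵘ (+ (a ℕ.* b)) 0               ≈⟨ *≡* (cong (ℤ._* + 1) (ℤ.pos-* a b)) ⟩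
  mkℚᵘ (+ a) 0 ℚᵘ.* mkℚᵘ (+ b) 0     ≈⟨ ℚᵘ.*-cong (toℚᵘ-fromℕ a) (toℚᵘ-fromℕ b) ⟨
  toℚᵘ (fromℕ a) ℚᵘ.* toℚᵘ (fromℕ b) ≈⟨ ℚ.toℚᵘ-homo-* (fromℕ a) (fromℕ b) ⟨
  toℚᵘ (fromℕ a ℚ.* fromℕ b)         ∎)
  where open import Relation.Binary.Reasoning.Setoid ℚᵘ.≃-setoid

fromℕ-^ : ∀ a n → fromℕ (a ℕ.^ n) ≡ fromℕ a ^ n
fromℕ-^ a zero    = refl
fromℕ-^ a (suc n) = trans (fromℕ-* a (a ℕ.^ n)) (cong (fromℕ a ℚ.*_) (fromℕ-^ a n))

fromℕ-mono-≤ : ∀ {a b} → a ℕ.≤ b → fromℕ a ℚ.≤ fromℕ b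
fromℕ-mono-≤ {a} {b} a≤b = ℚ.toℚᵘ-cancel-≤ (begin
  toℚᵘ (fromℕ a) ≃⟨ toℚᵘ-fromℕ a ⟩
  mkℚᵘ (+ a) 0   ≤⟨ *≤* (ℤ.*-monoʳ-≤-nonNeg (+ 1) (ℤ.+≤+ a≤b)) ⟩
  mkℚᵘ (+ b) 0   ≃⟨ toℚᵘ-fromℕ b ⟨
  toℚᵘ (fromℕ b) ∎)
  where open ℚᵘ.≤-Reasoning

^-exchange : ∀ a b n → (a ℕ.^ n) ℕ.^ b ≡ (a ℕ.^ b) ℕ.^ n
^-exchange a b n = trans (ℕ.^-*-assoc a n b)
  (trans (cong (a ℕ.^_) (ℕ.*-comm n b)) (sym (ℕ.^-*-assoc a b n)))

12^5n≤4^9n : ∀ n → (12 ℕ.^ n) ℕ.^ 5 ℕ.≤ (4 ℕ.^ n) ℕ.^ 9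
12^5n≤4^9n n = subst₂ ℕ._≤_ (^-exchange 12 n 5) (^-exchange 4 n 9)
  -- Numerically 248832 ≤ 262144; 5/9 lies just below log 4 / log 12.
  (ℕ.^-monoˡ-≤ n (ℕ.≤ᵇ⇒≤ (12 ℕ.^ 5) (4 ℕ.^ 9) _))

-- After ninth powers are taken, the upper bound on `N` gives `N ^ 5` at most the ninth power of
-- `4 ^ suc n`. The constant 1/4 absorbs the step from `suc n` back to `n`.
growth : ∀ {N} n → N ℕ.< 12 ℕ.^ suc n → (4 ℕ.^ n) ≥ + 1 / 4 · N ^ʳ (+ 5 / 9)
growth {N} n N<12ⁿ⁺¹ = begin
  (+ 1 / 4) ^ 9 ℚ.* fromℕ N ^ 5
    ≡⟨ cong ((+ 1 / 4) ^ 9 ℚ.*_) (fromℕ-^ N 5) ⟨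
  (+ 1 / 4) ^ 9 ℚ.* fromℕ (N ℕ.^ 5)
    ≤⟨ ℚ.*-monoˡ-≤-nonNeg ((+ 1 / 4) ^ 9) (fromℕ-mono-≤
         (ℕ.≤-trans (ℕ.^-monoˡ-≤ 5 (ℕ.<⇒≤ N<12ⁿ⁺¹)) (12^5n≤4^9n (suc n)))) ⟩
  (+ 1 / 4) ^ 9 ℚ.* fromℕ ((4 ℕ.^ suc n) ℕ.^ 9)
    ≡⟨ cong ((+ 1 / 4) ^ 9 ℚ.*_) (fromℕ-^ (4 ℕ.^ suc n) 9) ⟩
  (+ 1 / 4) ^ 9 ℚ.* fromℕ (4 ℕ.^ suc n) ^ 9
    ≡⟨ ^-distrib-* (+ 1 / 4) (fromℕ (4 ℕ.^ suc n)) 9 ⟨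
  (+ 1 / 4 ℚ.* fromℕ (4 ℕ.^ suc n)) ^ 9
    ≡⟨ cong (_^ 9) quarter ⟩
  fromℕ (4 ℕ.^ n) ^ 9
    ∎
  where
  open ℚ.≤-Reasoning

  quarter : + 1 / 4 ℚ.* fromℕ (4 ℕ.^ suc n) ≡ fromℕ (4 ℕ.^ n)
  quarter = trans (cong (+ 1 / 4 ℚ.*_) (fromℕ-* 4 (4 ℕ.^ n)))
    (trans (sym (ℚ.*-assoc (+ 1 / 4) (fromℕ 4) (fromℕ (4 ℕ.^ n))))
      -- The product of `+ 1 / 4` and `fromℕ 4` evaluates to one.
      (ℚ.*-identityˡ (fromℕ (4 ℕ.^ n))))

proposition1p4 : Σ[ c ∈ ℚ ] Σ[ c' ∈ ℚ ] c > 0ℚ × c' > 0ℚ ×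
    ((N : ℕ) → NonZero N → Σ[ A ∈ Subset 𝔽₂^∞ 0ℓ ] Σ[ k ∈ ℕ ]
    HasSize 𝔽₂^∞ A N × NonZero k × k ≥ c' · N ^ʳ (½ + c) × ¬ Stable 𝔽₂^∞ k A)
-- 1/18 is 5/9 - 1/2, and `½ + c` evaluates to the exponent 5/9 of `growth`.
proposition1p4 = + 1 / 18 , + 1 / 4 , ℚ.positive⁻¹ (+ 1 / 18) , ℚ.positive⁻¹ (+ 1 / 4) , λ N N≢0 →
  let n , 12ⁿ≤N , N<12ⁿ⁺¹ = power-bracket 12 (s≤s (s≤s z≤n)) N {{N≢0}}
      T = power baseTable n
  in image (enumeration T 12ⁿ≤N) , 4 ℕ.^ n
   , image-size (enumeration T 12ⁿ≤N) (enumeration-injective T 12ⁿ≤N)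
   , ℕ.m^n≢0 4 n
   , growth n N<12ⁿ⁺¹
   , λ stable → stable (image-orderProperty T 12ⁿ≤N)
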